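{- A lattice simplex $\Delta$ is Cayley of length $m$ if and only if the corresponding linear code $C_\Delta$ splits into $m$ parts.
   Context: Let $M\cong\mathbb{Z}^d$ be a lattice and $\Delta$ a $d$-dimensional lattice simplex in $M\otimes\mathbb{R}$ with vertices $v_0,\dots,v_d\in M$. $\Delta$ is Cayley of length $m$ if there is a lattice projection $M\cong\mathbb{Z}^d\to\mathbb{Z}^{m-1}$ (surjective affine lattice map) mapping $\Delta$ onto the standard simplex $\Delta_{m-1}=\operatorname{conv}(0,e_1,\dots,e_{m-1})$. Code of a simplex: $\mathbb{Z}_N=\mathbb{Z}/N\mathbb{Z}$. Let $\Lambda_\Delta=\{x\in(\mathbb{R}/\mathbb{Z})^{d+1}:\sum_i\{x_i\}(v_i,1)\in M\oplus\mathbb{Z}\}$, where $\{\cdot\}$ is the fractional part. $N_\Delta$ is the least common multiple of the denominators of all coordinates of elements of $\Lambda_\Delta$, and $C_\Delta=\{(N_\Delta\{x_0\},\dots,N_\Delta\{x_d\}):x\in\Lambda_\Delta\}\subseteq\mathbb{Z}_{N_\Delta}^{d+1}$. An extended linear code $C\subseteq\mathbb{Z}_N^{d+1}$ (all words have coordinate sum $0\bmod N$; $C_\Delta$ is extended) splits into $m$ parts if there is a set partition $I_1,\dots,I_m$ of $\{0,\dots,d\}$ into nonempty sets such that for every $j=1,\dots,m$ and every word $c\in C$ one has $\sum_{i\in I_j}c_i=0\bmod N$. -}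

module Defs where

open import Level using (Level; _⊔_; suc)
open import Algebra.Bundles using (CommutativeRing)
open import Algebra.Definitions.RawMonoid using (sum)
open import Data.Bool.Base using (if_then_else_)
open import Data.Fin.Base using (Fin; toℕ) renaming (zero to fzero; suc to fsuc)
open import Data.Fin.Subset using (Subset; Nonempty; _∈_)
open import Data.Integer.Base as ℤ using (ℤ; +_; -[1+_]; ∣_∣; 0ℤ; 1ℤ)
open import Data.Nat.Base as ℕ using (ℕ; pred; NonZero; +-0-rawMonoid)
open import Data.Nat.Coprimality using (Coprime)
open import Data.Nat.Divisibility using (_∣_; ∣-antisym)
open import Data.Product.Base using (Σ-syntax; ∃-syntax; _×_; _,_)
open import Data.Vec.Base using (lookup)
open import Data.Vec.Functional using (Vector)
open import Relation.Binary.PropositionalEquality.Core using (_≡_)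
open import Relation.Binary.Structures using (IsDecTotalOrder)
open import Relation.Nullary.Decidable.Core using (does)
open import Relation.Nullary.Negation.Core using (¬_)
open import Relation.Unary using (Pred)
import Data.Fin.Properties as Fin
import Data.Integer.Properties as ℤ

private
  variable
    c ℓ ℓ₁ ℓ₂ : Level

module _ (R : CommutativeRing c ℓ) where
  open CommutativeRing R
  open import Algebra.Definitions.RawMonoid +-rawMonoid using () renaming (_×_ to _·_)

  fromℤ : ℤ → Carrier
  fromℤ (+ n)    = n · 1#
  fromℤ -[1+ n ] = - (ℕ.suc n · 1#)

-- Classically, floor-lower and floor-upper can be satisfied exactly when
-- the ordered field is Archimedean, and they determine floor.  ℝ is the
-- intended model; completeness is not assumed.
record ArchimedeanOrderedField c ℓ₁ ℓ₂ : Set (suc (c ⊔ ℓ₁ ⊔ ℓ₂)) where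
  infix 4 _≤_
  field
    commutativeRing : CommutativeRing c ℓ₁
  open CommutativeRing commutativeRing public
  field
    _≤_             : Carrier → Carrier → Set ℓ₂
    isDecTotalOrder : IsDecTotalOrder _≈_ _≤_
    0≉1             : ¬ (0# ≈ 1#)
    inverse         : ∀ x → ¬ (x ≈ 0#) → ∃[ y ] x * y ≈ 1#
    +-monoˡ-≤       : ∀ z {x y} → x ≤ y → x + z ≤ y + z
    *-nonNegative   : ∀ {x y} → 0# ≤ x → 0# ≤ y → 0# ≤ x * y

  ι : ℤ → Carrier
  ι = fromℤ commutativeRing

  field
    floor       : Carrier → ℤ
    floor-lower : ∀ x → ι (floor x) ≤ x
    floor-upper : ∀ x → ¬ (ι (floor x) + 1# ≤ x)

  frac : Carrier → Carrier
  frac x = x - ι (floor x)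

  ∑ : ∀ {n} → Vector Carrier n → Carrier
  ∑ = sum +-rawMonoid

Lattice : ℕ → Set
Lattice d = Vector ℤ d

∑ℤ : ∀ {n} → Vector ℤ n → ℤ
∑ℤ = sum ℤ.+-0-rawMonoid

record AffineLatticeMap (d k : ℕ) : Set where
  field
    matrix      : Fin k → Fin d → ℤ
    translation : Lattice k

  onLattice : Lattice d → Lattice k
  onLattice u j = ∑ℤ (λ i → matrix j i ℤ.* u i) ℤ.+ translation j

IsLatticeProjection : ∀ {d k} → AffineLatticeMap d k → Set
IsLatticeProjection {d} {k} f =
  ∀ (w : Lattice k) → Σ[ u ∈ Lattice d ] (∀ j → onLattice u j ≡ w j)
  where open AffineLatticeMap f

standardVertex : ∀ {k} → Fin (ℕ.suc k) → Lattice k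
standardVertex fzero    j = 0ℤ
standardVertex (fsuc i) j = if does (i Fin.≟ j) then 1ℤ else 0ℤ

-- Fin N is used as the set of representatives 0, …, N - 1 of ℤ_N.
Word : ℕ → ℕ → Set
Word N n = Vector (Fin N) n

Code : ℕ → ℕ → (ℓ : Level) → Set (suc ℓ)
Code N n ℓ = Pred (Word N n) ℓ

record SetPartition (n m : ℕ) : Set where
  field
    part     : Fin m → Subset n
    nonempty : ∀ j → Nonempty (part j)
    disjoint : ∀ {i j k} → i ∈ part j → i ∈ part k → j ≡ k
    covering : ∀ i → ∃[ j ] i ∈ part j

sumOver : ∀ {n} → Subset n → Vector ℕ n → ℕ
sumOver I a = sum +-0-rawMonoid (λ i → if lookup I i then a i else 0)

-- Stated for an arbitrary set of words: neither linearity nor extendedness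
-- enters the condition, and simplex codes have both properties.
SplitsInto : ∀ {N n} (m : ℕ) → Code N n ℓ → Set ℓ
SplitsInto {N = N} {n} m C =
  Σ[ P ∈ SetPartition n m ]
    (∀ j w → C w → N ∣ sumOver (SetPartition.part P j) (λ i → toℕ (w i)))

IsLCM : Pred ℕ ℓ → ℕ → Set ℓ
IsLCM S N = (∀ q → S q → q ∣ N) × (∀ k → (∀ q → S q → q ∣ k) → N ∣ k)

IsLCM-unique : ∀ {S : Pred ℕ ℓ} {M N} → IsLCM S M → IsLCM S N → M ≡ N
IsLCM-unique (upM , leastM) (upN , leastN) = ∣-antisym (leastM _ upN) (leastN _ upM)

module _ (K : ArchimedeanOrderedField c ℓ₁ ℓ₂) where
  open ArchimedeanOrderedField K

  -- ℤᵈ ⊗ K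
  Space : ℕ → Set c
  Space d = Vector Carrier d

  embed : ∀ {d} → Lattice d → Space d
  embed u j = ι (u j)

  _≋_ : ∀ {d} → Space d → Space d → Set ℓ₁
  p ≋ q = ∀ j → p j ≈ q j

  combination : ∀ {n d} → Vector Carrier n → (Fin n → Space d) → Space d
  combination a p j = ∑ (λ i → a i * p i j)

  AffinelyIndependent : ∀ {n d} → (Fin n → Space d) → Set (c ⊔ ℓ₁)
  AffinelyIndependent {n} p =
    ∀ (a : Vector Carrier n) → ∑ a ≈ 0# → combination a p ≋ (λ _ → 0#) → ∀ i → a i ≈ 0#

  conv : ∀ {n d} → (Fin n → Space d) → Pred (Space d) (c ⊔ ℓ₁ ⊔ ℓ₂)
  conv {n} p q =
    Σ[ a ∈ Vector Carrier n ] (∀ i → 0# ≤ a i) × ∑ a ≈ 1# × combination a p ≋ q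

  onSpace : ∀ {d k} → AffineLatticeMap d k → Space d → Space k
  onSpace f p j = ∑ (λ i → ι (matrix j i) * p i) + ι (translation j)
    where open AffineLatticeMap f

  record LatticeSimplex (d : ℕ) : Set (c ⊔ ℓ₁) where
    field
      vertex              : Fin (ℕ.suc d) → Lattice d
      affinelyIndependent : AffinelyIndependent (λ i → embed (vertex i))

  module _ {d : ℕ} (Δ : LatticeSimplex d) where
    open LatticeSimplex Δ

    points : Pred (Space d) (c ⊔ ℓ₁ ⊔ ℓ₂)
    points = conv (λ i → embed (vertex i))

    MapsOnto : ∀ {k} → AffineLatticeMap d k → Pred (Space k) ℓ → Set (c ⊔ ℓ₁ ⊔ ℓ₂ ⊔ ℓ)
    MapsOnto {k = k} f T =
      (∀ p → points p → T (onSpace f p)) ×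
      (∀ q → T q → Σ[ p ∈ Space d ] points p × onSpace f p ≋ q)

    -- Only meaningful for m ≥ 1.
    IsCayleyOfLength : ℕ → Set (c ⊔ ℓ₁ ⊔ ℓ₂)
    IsCayleyOfLength m =
      Σ[ f ∈ AffineLatticeMap d (pred m) ]
        IsLatticeProjection f × MapsOnto f (conv (λ i → embed (standardVertex i)))

    -- Elements of (K/ℤ)^{d+1} are given by representatives in K^{d+1}; all
    -- conditions below involve only the fractional parts of the coordinates.
    -- The point Σ {xᵢ} (vᵢ , 1) is the pair with components
    -- Σ {xᵢ} vᵢ and Σ {xᵢ}.
    Λ : Pred (Vector Carrier (ℕ.suc d)) ℓ₁
    Λ x =
      (Σ[ u ∈ Lattice d ] combination (λ i → frac (x i)) (λ i → embed (vertex i)) ≋ embed u) ×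
      (∃[ z ] ∑ (λ i → frac (x i)) ≈ ι z)

    IsDenominator : Carrier → ℕ → Set ℓ₁
    IsDenominator x q = NonZero q × ∃[ p ] ι (+ q) * x ≈ ι p × Coprime ∣ p ∣ q

    IsCoordinateDenominator : Pred ℕ (c ⊔ ℓ₁)
    IsCoordinateDenominator q = ∃[ x ] Λ x × ∃[ i ] IsDenominator (frac (x i)) q

    IsCodeModulus : ℕ → Set (c ⊔ ℓ₁)
    IsCodeModulus = IsLCM IsCoordinateDenominator

    simplexCode : (N : ℕ) → Code N (ℕ.suc d) (c ⊔ ℓ₁)
    simplexCode N w = ∃[ x ] Λ x × (∀ i → ι (+ N) * frac (x i) ≈ ι (+ toℕ (w i)))

{-# OPTIONS --safe #-}
module Submission where

-- Let A be the matrix with rows (1 , vᵢ).  Affine independence makes A invertible with rational inverse,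
-- the rows of A⁻¹ generate Λ modulo ℤ^(d+1), and N is the common denominator of the entries of A⁻¹.
-- An affine map sending each vᵢ to the standard vertex σ(i) has as its coefficients the sums of the
-- rows of A⁻¹ over the fibres of σ; these are integers exactly when the code splits along the fibres.
-- Conversely, a Cayley projection sends each vᵢ to a lattice point of the standard simplex, that is
-- to a vertex, and this defines σ.

open import Defs
open import Data.Bool.Base using (true; false; if_then_else_)
open import Data.Empty using (⊥-elim)
open import Data.Fin.Base using (Fin; toℕ; fromℕ<; punchIn) renaming (zero to fzero; suc to fsuc)
open import Data.Fin.Properties using (_≟_; any?; toℕ-fromℕ<)
open import Data.Fin.Subset using (Subset; _∈_)
open import Data.Integer.Base as ℤ using (ℤ; +_; -[1+_]; ∣_∣; 0ℤ; 1ℤ)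
open import Data.Integer.Tactic.RingSolver using (solve-∀)
open import Data.Nat.Base as ℕ using (ℕ; zero; suc; NonZero)
open import Data.Nat.Coprimality as Coprimality using (Coprime; coprime-divisor)
open import Data.Nat.Divisibility using (_∣_; divides; ∣-trans; 1∣_)
open import Data.Nat.GCD using (gcd)
open import Data.Nat.LCM using (lcm; m∣lcm[m,n]; n∣lcm[m,n]; lcm-least; gcd*lcm)
open import Data.Product.Base using (Σ-syntax; ∃-syntax; _×_; _,_; proj₁; proj₂)
open import Data.Sum.Base using (inj₁; inj₂; [_,_]′)
open import Data.Vec.Base using (lookup; tabulate)
open import Data.Vec.Functional as Vector using (Vector; insertAt)
open import Data.Vec.Functional.Properties using (insertAt-lookup; insertAt-punchIn)
open import Data.Vec.Properties using (lookup∘tabulate; lookup⇒[]=; []=⇒lookup)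
open import Function.Base using (_∘_)
open import Function.Bundles using (_⇔_; mk⇔)
open import Relation.Binary.PropositionalEquality as ≡ using (_≡_; _≢_)
open import Relation.Binary.Structures using (IsDecTotalOrder)
open import Relation.Nullary.Decidable using (does; yes; no; ¬?; dec-true; dec-false; decidable-stable)
open import Relation.Nullary.Negation using (¬_; contradiction; contradiction-irr)
import Algebra.Properties.Ring as RingProperties
import Algebra.Properties.Semiring.Mult as SemiringMult
import Algebra.Properties.Semiring.Sum as SemiringSum
import Data.Integer.Divisibility.Signed as ℤ using (∣ᵤ⇒∣; ∣⇒∣ᵤ; ∣m+n∣n⇒∣m; ∣m⇒∣-m; ∣m⇒∣m*n)
import Data.Integer.GCD as ℤ using (gcd; gcd[i,j]≡0⇒j≡0)
import Data.Integer.Properties as ℤ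
import Data.Nat.Properties as ℕ
import Data.Rational.Base as ℚ
import Data.Rational.Properties as ℚ
import Relation.Binary.Reasoning.Setoid as SetoidReasoning

-- The field `K` may contain irrational numbers, so it is not given that coordinates of elements of
-- Λ have denominators, nor that a modulus exists. The inverse is therefore extracted from an
-- integer linear relation, found by elimination without division, which makes its entries quotients
-- of integers by construction. Both implications meet in one quantity, the weight `push σ a c` that
-- a vector `a` places on the fibre of `c`. When `a` consists of fractional parts of an element of
-- Λ, `N` times this weight is the sum of a code word over the fibre, so the weight is integral
-- exactly when `N` divides that sum. The entries of `A⁻¹` need not lie between 0 and 1, but
-- dropping their integer parts changes fibre weights only by integers.

private
  module ∑ℤ = SemiringSum ℤ.+-*-semiring

-- Linear relations over the integers.

∑ℤ-zero : ∀ {n} {a : Vector ℤ n} → (∀ i → a i ≡ 0ℤ) → ∑ℤ a ≡ 0ℤ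
∑ℤ-zero {n} a≡0 = ≡.trans (∑ℤ.sum-cong-≗ a≡0) (∑ℤ.sum-replicate-zero n)

-- Lifts a relation `c` among the reduced vectors `π p k - a k q` to the original ones: each `p k`
-- receives `π c k`, and the pivot `q` absorbs the rest.
∑ℤ-eliminate : ∀ {n} (c a p : Vector ℤ n) (π q : ℤ) →
  (ℤ.- ∑ℤ (λ k → c k ℤ.* a k)) ℤ.* q ℤ.+ ∑ℤ (λ k → π ℤ.* c k ℤ.* p k) ≡
  ∑ℤ (λ k → c k ℤ.* (π ℤ.* p k ℤ.- a k ℤ.* q))
∑ℤ-eliminate {zero}  c a p π q = ≡.cong (ℤ._+ 0ℤ) (ℤ.*-zeroˡ q)
∑ℤ-eliminate {suc n} c a p π q =
  ≡.trans (regroup (c fzero) (a fzero) (p fzero) π q _ _)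
    (≡.cong (λ t → c fzero ℤ.* (π ℤ.* p fzero ℤ.- a fzero ℤ.* q) ℤ.+ t)
      (∑ℤ-eliminate (c ∘ fsuc) (a ∘ fsuc) (p ∘ fsuc) π q))
  where
  regroup : ∀ c a p π q s t →
    (ℤ.- (c ℤ.* a ℤ.+ s)) ℤ.* q ℤ.+ (π ℤ.* c ℤ.* p ℤ.+ t) ≡
    c ℤ.* (π ℤ.* p ℤ.- a ℤ.* q) ℤ.+ ((ℤ.- s) ℤ.* q ℤ.+ t)
  regroup = solve-∀

-- Gaussian elimination on the first coordinate, with cross multiplication in place of division so
-- that coefficients stay in ℤ. The excess of one vector over the dimension survives each step.
linearRelation : ∀ n (p : Fin (suc n) → Lattice n) →
  Σ[ c ∈ Vector ℤ (suc n) ] (∃[ i ] c i ≢ 0ℤ) × (∀ j → ∑ℤ (λ i → c i ℤ.* p i j) ≡ 0ℤ)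
linearRelation zero    p = (λ _ → 1ℤ) , (fzero , λ ()) , λ ()
linearRelation (suc n) p with any? (λ i → ¬? (p i fzero ℤ.≟ 0ℤ))
... | no  p≡0 =
  let (c , (i , cᵢ≢0) , rel) = linearRelation n (λ i j → p (fsuc i) (fsuc j))
      vanishes i = decidable-stable (p i fzero ℤ.≟ 0ℤ) (λ pᵢ≢0 → p≡0 (i , pᵢ≢0))
      c′ = 0ℤ Vector.∷ c
  in c′ , (fsuc i , cᵢ≢0) , λ
    { fzero    → ∑ℤ-zero (λ i → ≡.trans (≡.cong (c′ i ℤ.*_) (vanishes i)) (ℤ.*-zeroʳ (c′ i)))
    ; (fsuc j) → ≡.trans (ℤ.+-identityˡ (∑ℤ (λ i → c i ℤ.* p (fsuc i) (fsuc j)))) (rel j)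
    }
... | yes (i₀ , π≢0) = c′ , (punchIn i₀ (proj₁ c≢0) , c′≢0) , rel′
  where
  π = p i₀ fzero
  p′ = p ∘ punchIn i₀
  -- Coordinate `fzero` of every `q k` cancels, so the induction hypothesis is needed only for the
  -- remaining coordinates.
  q : Fin (suc n) → Lattice (suc n)
  q k j = π ℤ.* p′ k j ℤ.- p′ k fzero ℤ.* p i₀ j
  IH = linearRelation n (λ k j → q k (fsuc j))
  c = proj₁ IH
  c≢0 = proj₁ (proj₂ IH)
  s = ∑ℤ (λ k → c k ℤ.* p′ k fzero)
  c″ = λ k → π ℤ.* c k
  c′ = insertAt c″ i₀ (ℤ.- s)
  c′≢0 : c′ (punchIn i₀ (proj₁ c≢0)) ≢ 0ℤ
  c′≢0 eq = [ π≢0 , proj₂ c≢0 ]′ (ℤ.i*j≡0⇒i≡0∨j≡0 π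
    (≡.trans (≡.sym (insertAt-punchIn c″ i₀ (ℤ.- s) (proj₁ c≢0))) eq))
  rel : ∀ j → ∑ℤ (λ k → c k ℤ.* q k j) ≡ 0ℤ
  rel fzero    = ∑ℤ-zero (λ k → ≡.trans
    (≡.cong (c k ℤ.*_) (ℤ.i≡j⇒i-j≡0 (ℤ.*-comm π (p′ k fzero)))) (ℤ.*-zeroʳ (c k)))
  rel (fsuc j) = proj₂ (proj₂ IH) j
  rel′ : ∀ j → ∑ℤ (λ i → c′ i ℤ.* p i j) ≡ 0ℤ
  rel′ j = begin
    ∑ℤ (λ i → c′ i ℤ.* p i j)
      ≡⟨ ∑ℤ.sum-remove {i = i₀} (λ i → c′ i ℤ.* p i j) ⟩
    c′ i₀ ℤ.* p i₀ j ℤ.+ ∑ℤ (λ k → c′ (punchIn i₀ k) ℤ.* p′ k j)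
      ≡⟨ ≡.cong₂ ℤ._+_ (≡.cong (ℤ._* p i₀ j) (insertAt-lookup c″ i₀ (ℤ.- s)))
           (∑ℤ.sum-cong-≗ (λ k → ≡.cong (ℤ._* p′ k j) (insertAt-punchIn c″ i₀ (ℤ.- s) k))) ⟩
    (ℤ.- s) ℤ.* p i₀ j ℤ.+ ∑ℤ (λ k → π ℤ.* c k ℤ.* p′ k j)
      ≡⟨ ∑ℤ-eliminate c (λ k → p′ k fzero) (λ k → p′ k j) π (p i₀ j) ⟩
    ∑ℤ (λ k → c k ℤ.* q k j)
      ≡⟨ rel j ⟩
    0ℤ ∎
    where open ≡.≡-Reasoning

-- Least common multiples, reduced fractions and natural vectors.

lcm-nonZero : ∀ m n → .{{NonZero m}} → .{{NonZero n}} → NonZero (lcm m n)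
lcm-nonZero m n = ℕ.≢-nonZero λ lcm≡0 → ℕ.≢-nonZero⁻¹ (m ℕ.* n) {{ℕ.m*n≢0 m n}}
  (≡.trans (≡.sym (gcd*lcm m n)) (≡.trans (≡.cong (gcd m n ℕ.*_) lcm≡0) (ℕ.*-zeroʳ (gcd m n))))

finiteLCM : ∀ {n} (q : Vector ℕ n) → (∀ i → NonZero (q i)) →
  ∃[ N ] NonZero N × (∀ i → q i ∣ N) × (∀ k → (∀ i → q i ∣ k) → N ∣ k)
finiteLCM {zero}  q q≢0 = 1 , _ , (λ ()) , λ k _ → 1∣ k
finiteLCM {suc n} q q≢0 =
  let (N , N≢0 , q∣N , least) = finiteLCM (q ∘ fsuc) (q≢0 ∘ fsuc)
  in lcm (q fzero) N , lcm-nonZero (q fzero) N {{q≢0 fzero}} {{N≢0}}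
   , (λ { fzero → m∣lcm[m,n] (q fzero) N
        ; (fsuc i) → ∣-trans (q∣N i) (n∣lcm[m,n] (q fzero) N) })
   , λ k q∣k → lcm-least (q∣k fzero) (least k (q∣k ∘ fsuc))

-- Common divisors with `q` are unaffected by multiples of `q`; this carries reduced fractions
-- through `frac`.
coprime-sub : ∀ p q z → Coprime ∣ p ∣ q → Coprime ∣ p ℤ.- + q ℤ.* z ∣ q
coprime-sub p q z p⊥q {e} (e∣p-qz , e∣q) = p⊥q (ℤ.∣⇒∣ᵤ {+ e} {p} (ℤ.∣m+n∣n⇒∣m {+ e} {p}
  (ℤ.∣ᵤ⇒∣ e∣p-qz) (ℤ.∣m⇒∣-m (ℤ.∣m⇒∣m*n z (ℤ.∣ᵤ⇒∣ {+ e} {+ q} e∣q)))) , e∣q)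

-- The coprimality stored in a rational is irrelevant, but it is decidable and can be recomputed.
reduced-coprime : ∀ r → Coprime ∣ ℚ.↥ r ∣ (ℚ.↧ₙ r)
reduced-coprime (ℚ.mkℚ _ _ coprime) = Coprimality.recompute coprime

∑ℕ : ∀ {n} → Vector ℕ n → ℕ
∑ℕ = SemiringSum.sum ℕ.+-*-semiring

δℕ : ∀ {n} → Fin n → Fin n → ℕ
δℕ i j = if does (i ≟ j) then 1 else 0

∑ℕ≡0⇒≡0 : ∀ {n} (a : Vector ℕ n) → ∑ℕ a ≡ 0 → ∀ i → a i ≡ 0
∑ℕ≡0⇒≡0 a ∑≡0 fzero    = ℕ.m+n≡0⇒m≡0 (a fzero) ∑≡0
∑ℕ≡0⇒≡0 a ∑≡0 (fsuc i) = ∑ℕ≡0⇒≡0 (a ∘ fsuc) (ℕ.m+n≡0⇒n≡0 (a fzero) ∑≡0) i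

-- In barycentric coordinates this says that the only lattice points of the standard simplex are its
-- vertices.
∑ℕ≡1⇒unit : ∀ {n} (a : Vector ℕ n) → ∑ℕ a ≡ 1 → ∃[ i ] (∀ j → a j ≡ δℕ i j)
∑ℕ≡1⇒unit {suc n} a ∑≡1 with a fzero in a₀
... | zero =
  let (i , unit) = ∑ℕ≡1⇒unit (a ∘ fsuc) ∑≡1
  in fsuc i , λ { fzero → a₀ ; (fsuc j) → unit j }
... | suc zero = fzero , λ { fzero → a₀ ; (fsuc j) → ∑ℕ≡0⇒≡0 (a ∘ fsuc) (ℕ.suc-injective ∑≡1) j }

-- Partitions as fibres of surjections.

module FibrePartition {n m} (σ : Fin n → Fin m) (σ-surjective : ∀ c → ∃[ i ] σ i ≡ c) where
  fibre : Fin m → Subset n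
  fibre c = tabulate (λ i → does (σ i ≟ c))

  lookup-fibre : ∀ c i → lookup (fibre c) i ≡ does (σ i ≟ c)
  lookup-fibre c = lookup∘tabulate (λ i → does (σ i ≟ c))

  ∈-fibre⁺ : ∀ {i c} → σ i ≡ c → i ∈ fibre c
  ∈-fibre⁺ {i} {c} σi≡c = lookup⇒[]= i (fibre c) (≡.trans (lookup-fibre c i) (dec-true (σ i ≟ c) σi≡c))

  ∈-fibre⁻ : ∀ {i c} → i ∈ fibre c → σ i ≡ c
  ∈-fibre⁻ {i} {c} i∈ with σ i ≟ c | ≡.trans (≡.sym (lookup-fibre c i)) ([]=⇒lookup i∈)
  ... | yes σi≡c | _  = σi≡c
  ... | no  _    | ()

  partition : SetPartition n m
  partition = record
    { part     = fibre
    ; nonempty = λ c → proj₁ (σ-surjective c) , ∈-fibre⁺ (proj₂ (σ-surjective c))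
    ; disjoint = λ i∈j i∈k → ≡.trans (≡.sym (∈-fibre⁻ i∈j)) (∈-fibre⁻ i∈k)
    ; covering = λ i → σ i , ∈-fibre⁺ ≡.refl
    }

module PartitionMap {n m} (P : SetPartition n m) where
  open SetPartition P public using (part)
  open SetPartition P using (nonempty; disjoint; covering)

  σ : Fin n → Fin m
  σ i = proj₁ (covering i)

  representative : Fin m → Fin n
  representative c = proj₁ (nonempty c)

  σ-representative : ∀ c → σ (representative c) ≡ c
  σ-representative c = disjoint (proj₂ (covering (representative c))) (proj₂ (nonempty c))

  -- Brings the indicator of a part into the same boolean form as `lookup-fibre`, so that
  -- `scaled-push` serves both implications.
  lookup-part : ∀ c i → lookup (part c) i ≡ does (σ i ≟ c)
  lookup-part c i with σ i ≟ c | lookup (part c) i in eq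
  ... | yes ≡.refl | _     = ≡.trans (≡.sym eq) ([]=⇒lookup (proj₂ (covering i)))
  ... | no  σi≢c   | true  = contradiction (disjoint (proj₂ (covering i)) (lookup⇒[]= i (part c) eq)) σi≢c
  ... | no  _      | false = ≡.refl

module _ {c ℓ₁ ℓ₂} (K : ArchimedeanOrderedField c ℓ₁ ℓ₂) where
  open ArchimedeanOrderedField K
  open IsDecTotalOrder isDecTotalOrder using (antisym; total; ≤-respˡ-≈; ≤-respʳ-≈)
    renaming (trans to ≤-trans; refl to ≤-refl)
  open RingProperties ring using (-‿distribˡ-*; -‿distribʳ-*; x[y-z]≈xy-xz; [y-z]x≈yx-zx; -0#≈0#;
    -‿involutive; -‿anti-homo-+; -‿+-comm; +-inverseʳ-unique; x∙y⁻¹≈ε⇒x≈y; x≈y⇒x∙y⁻¹≈ε)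
  open SemiringMult semiring using (×-homo-+; ×1-homo-*) renaming (_×_ to _·_)
  open SemiringSum semiring using (sum-cong-≋; sum-cong-≗; sum-replicate-zero; ∑-distrib-+; ∑-comm;
    *-distribˡ-sum; *-distribʳ-sum)
  open SetoidReasoning setoid

  -- The integers inside the field, and the order.

  ι-1 : ι 1ℤ ≈ 1#
  ι-1 = +-identityʳ 1#

  ι-neg : ∀ i → ι (ℤ.- i) ≈ - ι i
  ι-neg (+ zero)  = sym -0#≈0#
  ι-neg (+ suc n) = refl
  ι-neg -[1+ n ]  = sym (-‿involutive _)

  cancel-shared : ∀ x y z → (x + y) - (x + z) ≈ y - z
  cancel-shared x y z = begin
    (x + y) - (x + z)     ≈⟨ +-cong (+-comm x y) (-‿anti-homo-+ x z) ⟩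
    (y + x) + (- z - x)   ≈⟨ +-congˡ (+-comm (- z) (- x)) ⟩
    (y + x) + (- x - z)   ≈⟨ +-assoc y x _ ⟩
    y + (x + (- x - z))   ≈⟨ +-congˡ (+-assoc x (- x) (- z)) ⟨
    y + ((x - x) - z)     ≈⟨ +-congˡ (+-congʳ (-‿inverseʳ x)) ⟩
    y + (0# - z)          ≈⟨ +-congˡ (+-identityˡ (- z)) ⟩
    y - z                 ∎

  ι-⊖ : ∀ m n → ι (m ℤ.⊖ n) ≈ m · 1# - n · 1#
  ι-⊖ m       zero    = sym (trans (+-congˡ -0#≈0#) (+-identityʳ _))
  ι-⊖ zero    (suc n) = sym (+-identityˡ _)
  ι-⊖ (suc m) (suc n) = begin
    ι (suc m ℤ.⊖ suc n)     ≡⟨ ≡.cong ι (ℤ.[1+m]⊖[1+n]≡m⊖n m n) ⟩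
    ι (m ℤ.⊖ n)             ≈⟨ ι-⊖ m n ⟩
    m · 1# - n · 1#         ≈⟨ cancel-shared 1# _ _ ⟨
    suc m · 1# - suc n · 1# ∎

  ι-+ : ∀ i j → ι (i ℤ.+ j) ≈ ι i + ι j
  ι-+ (+ m)    (+ n)    = ×-homo-+ 1# m n
  ι-+ (+ m)    -[1+ n ] = ι-⊖ m (suc n)
  ι-+ -[1+ m ] (+ n)    = trans (ι-⊖ n (suc m)) (+-comm _ _)
  ι-+ -[1+ m ] -[1+ n ] = begin
    - (suc (suc (m ℕ.+ n)) · 1#)      ≡⟨ ≡.cong (λ k → - (suc k · 1#)) (ℕ.+-suc m n) ⟨
    - ((suc m ℕ.+ suc n) · 1#)        ≈⟨ -‿cong (×-homo-+ 1# (suc m) (suc n)) ⟩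
    - (suc m · 1# + suc n · 1#)       ≈⟨ -‿anti-homo-+ _ _ ⟩
    - (suc n · 1#) - suc m · 1#       ≈⟨ +-comm _ _ ⟩
    - (suc m · 1#) - suc n · 1#       ∎

  ι-*-pos : ∀ m j → ι (+ m ℤ.* j) ≈ ι (+ m) * ι j
  ι-*-pos m (+ n)    = begin
    ι (+ m ℤ.* + n)          ≡⟨ ≡.cong ι (ℤ.pos-* m n) ⟨
    (m ℕ.* n) · 1#           ≈⟨ ×1-homo-* m n ⟩
    m · 1# * n · 1#          ∎
  ι-*-pos m -[1+ n ] = begin
    ι (+ m ℤ.* ℤ.- (+ suc n))   ≡⟨ ≡.cong ι (ℤ.neg-distribʳ-* (+ m) (+ suc n)) ⟨
    ι (ℤ.- (+ m ℤ.* + suc n))   ≈⟨ ι-neg (+ m ℤ.* + suc n) ⟩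
    - ι (+ m ℤ.* + suc n)       ≈⟨ -‿cong (ι-*-pos m (+ suc n)) ⟩
    - (ι (+ m) * ι (+ suc n))   ≈⟨ -‿distribʳ-* _ _ ⟩
    ι (+ m) * - ι (+ suc n)     ∎

  ι-* : ∀ i j → ι (i ℤ.* j) ≈ ι i * ι j
  ι-* (+ m)    j = ι-*-pos m j
  ι-* -[1+ m ] j = begin
    ι (ℤ.- (+ suc m) ℤ.* j)   ≡⟨ ≡.cong ι (ℤ.neg-distribˡ-* (+ suc m) j) ⟨
    ι (ℤ.- (+ suc m ℤ.* j))   ≈⟨ ι-neg (+ suc m ℤ.* j) ⟩
    - ι (+ suc m ℤ.* j)       ≈⟨ -‿cong (ι-*-pos (suc m) j) ⟩
    - (ι (+ suc m) * ι j)     ≈⟨ -‿distribˡ-* _ _ ⟩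
    - ι (+ suc m) * ι j       ∎

  ι-sub : ∀ i j → ι (i ℤ.- j) ≈ ι i - ι j
  ι-sub i j = trans (ι-+ i (ℤ.- j)) (+-congˡ (ι-neg j))

  ι-∑ : ∀ {n} (a : Vector ℤ n) → ι (∑ℤ a) ≈ ∑ (ι ∘ a)
  ι-∑ {zero}  a = refl
  ι-∑ {suc n} a = trans (ι-+ (a fzero) _) (+-congˡ (ι-∑ (a ∘ fsuc)))

  ι-∑ℕ : ∀ {n} (a : Vector ℕ n) → ι (+ ∑ℕ a) ≈ ∑ (λ i → ι (+ a i))
  ι-∑ℕ {zero}  a = refl
  ι-∑ℕ {suc n} a = trans (ι-+ (+ a fzero) (+ ∑ℕ (a ∘ fsuc))) (+-congˡ (ι-∑ℕ (a ∘ fsuc)))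

  ≤-resp-≈ : ∀ {x x′ y y′} → x ≈ x′ → y ≈ y′ → x ≤ y → x′ ≤ y′
  ≤-resp-≈ x≈ y≈ x≤y = ≤-respʳ-≈ y≈ (≤-respˡ-≈ x≈ x≤y)

  +-nonNegative : ∀ {x y} → 0# ≤ x → 0# ≤ y → 0# ≤ x + y
  +-nonNegative {x} {y} 0≤x 0≤y = ≤-trans 0≤y (≤-respˡ-≈ (+-identityˡ y) (+-monoˡ-≤ y 0≤x))

  ∑-nonNegative : ∀ {n} {a : Vector Carrier n} → (∀ i → 0# ≤ a i) → 0# ≤ ∑ a
  ∑-nonNegative {zero}  0≤a = ≤-refl
  ∑-nonNegative {suc n} 0≤a = +-nonNegative (0≤a fzero) (∑-nonNegative (0≤a ∘ fsuc))

  ≤⇒0≤- : ∀ {x y} → x ≤ y → 0# ≤ y - x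
  ≤⇒0≤- {x} x≤y = ≤-respˡ-≈ (-‿inverseʳ x) (+-monoˡ-≤ (- x) x≤y)

  0≤-⇒≤ : ∀ {x y} → 0# ≤ y - x → x ≤ y
  0≤-⇒≤ {x} {y} 0≤y-x = ≤-resp-≈ (+-identityˡ x)
    (trans (+-assoc y (- x) x) (trans (+-congˡ (-‿inverseˡ x)) (+-identityʳ y)))
    (+-monoˡ-≤ x 0≤y-x)

  -- 1 = (-1)², which is nonnegative whatever the sign of 1.
  0≤1 : 0# ≤ 1#
  0≤1 with total 0# 1#
  ... | inj₁ 0≤1 = 0≤1
  ... | inj₂ 1≤0 = ≤-respʳ-≈
    (begin
      (0# - 1#) * (0# - 1#)  ≈⟨ *-cong (+-identityˡ _) (+-identityˡ _) ⟩
      - 1# * - 1#            ≈⟨ -‿distribˡ-* 1# (- 1#) ⟨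
      - (1# * - 1#)          ≈⟨ -‿cong (*-identityˡ _) ⟩
      - (- 1#)               ≈⟨ -‿involutive 1# ⟩
      1#                     ∎)
    (*-nonNegative (≤⇒0≤- 1≤0) (≤⇒0≤- 1≤0))

  0≤ι+ : ∀ n → 0# ≤ ι (+ n)
  0≤ι+ zero    = ≤-refl
  0≤ι+ (suc n) = +-nonNegative 0≤1 (0≤ι+ n)

  -- Adding 1 to `0 ≤ ι (+ n)` would give `1 ≤ 0`, against `0≉1`. Characteristic zero and
  -- injectivity of `ι` follow from this.
  ι-suc≰0 : ∀ n → ¬ (ι (+ suc n) ≤ 0#)
  ι-suc≰0 n s≤0 = 0≉1 (antisym 0≤1 (≤-trans
    (0≤-⇒≤ (≤-respʳ-≈ (sym (trans (+-congʳ (+-comm _ _)) (trans (+-assoc _ _ _)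
      (trans (+-congˡ (-‿inverseʳ 1#)) (+-identityʳ _))))) (0≤ι+ n))) s≤0))

  ι-nonNegative⁻¹ : ∀ i → 0# ≤ ι i → ∃[ n ] i ≡ + n
  ι-nonNegative⁻¹ (+ n)    _   = n , ≡.refl
  ι-nonNegative⁻¹ -[1+ n ] 0≤- = ⊥-elim (ι-suc≰0 n (0≤-⇒≤ (≤-respʳ-≈ (sym (+-identityˡ _)) 0≤-)))

  ι≈0⇒≡0 : ∀ i → ι i ≈ 0# → i ≡ 0ℤ
  ι≈0⇒≡0 (+ zero)  _  = ≡.refl
  ι≈0⇒≡0 (+ suc n) ≈0 = ⊥-elim (ι-suc≰0 n (≤-respʳ-≈ ≈0 ≤-refl))
  ι≈0⇒≡0 -[1+ n ]  ≈0 = ⊥-elim (ι-suc≰0 n (≤-respʳ-≈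
    (trans (sym (-‿involutive _)) (trans (-‿cong ≈0) -0#≈0#)) ≤-refl))

  ι-injective : ∀ {i j} → ι i ≈ ι j → i ≡ j
  ι-injective {i} {j} eq = ℤ.i-j≡0⇒i≡j i j (ι≈0⇒≡0 _ (trans (ι-sub i j) (x≈y⇒x∙y⁻¹≈ε eq)))

  ι+≉0 : ∀ n → .{{NonZero n}} → ¬ (ι (+ n) ≈ 0#)
  ι+≉0 n eq = ℕ.≢-nonZero⁻¹ n (ℤ.+-injective (ι≈0⇒≡0 (+ n) eq))

  *-cancelˡ-≈ : ∀ z {x y} → ¬ (z ≈ 0#) → z * x ≈ z * y → x ≈ y
  *-cancelˡ-≈ z {x} {y} z≉0 zx≈zy = let (z⁻¹ , inv) = inverse z z≉0 in begin
    x               ≈⟨ *-identityˡ x ⟨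
    1# * x          ≈⟨ *-congʳ (trans (*-comm z⁻¹ z) inv) ⟨
    z⁻¹ * z * x     ≈⟨ *-assoc z⁻¹ z x ⟩
    z⁻¹ * (z * x)   ≈⟨ *-congˡ zx≈zy ⟩
    z⁻¹ * (z * y)   ≈⟨ *-assoc z⁻¹ z y ⟨
    z⁻¹ * z * y     ≈⟨ *-congʳ (trans (*-comm z⁻¹ z) inv) ⟩
    1# * y          ≈⟨ *-identityˡ y ⟩
    y               ∎

  *-swap : ∀ x y z → x * (y * z) ≈ y * (x * z)
  *-swap x y z = trans (sym (*-assoc x y z)) (trans (*-congʳ (*-comm x y)) (*-assoc y x z))

  0≤frac : ∀ x → 0# ≤ frac x
  0≤frac x = ≤⇒0≤- (floor-lower x)

  frac+floor : ∀ x → frac x + ι (floor x) ≈ x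
  frac+floor x = trans (+-assoc x _ _) (trans (+-congˡ (-‿inverseˡ _)) (+-identityʳ x))

  frac<1 : ∀ x → ¬ (1# ≤ frac x)
  frac<1 x 1≤ = floor-upper x (≤-resp-≈ (+-comm 1# (ι (floor x))) (frac+floor x)
    (+-monoˡ-≤ (ι (floor x)) 1≤))

  -- Integral elements, Kronecker deltas and finite sums.

  Integral : Carrier → Set ℓ₁
  Integral x = ∃[ z ] x ≈ ι z

  integral-resp : ∀ {x y} → y ≈ x → Integral x → Integral y
  integral-resp y≈x (z , x≈z) = z , trans y≈x x≈z

  integral-ι : ∀ z → Integral (ι z)
  integral-ι z = z , refl

  integral-+ : ∀ {x y} → Integral x → Integral y → Integral (x + y)
  integral-+ (a , x≈a) (b , y≈b) = a ℤ.+ b , trans (+-cong x≈a y≈b) (sym (ι-+ a b))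

  integral-- : ∀ {x y} → Integral x → Integral y → Integral (x - y)
  integral-- (a , x≈a) (b , y≈b) = a ℤ.- b , trans (+-cong x≈a (-‿cong y≈b)) (sym (ι-sub a b))

  integral-* : ∀ {x y} → Integral x → Integral y → Integral (x * y)
  integral-* (a , x≈a) (b , y≈b) = a ℤ.* b , trans (*-cong x≈a y≈b) (sym (ι-* a b))

  integral-∑ : ∀ {n} {a : Vector Carrier n} → (∀ i → Integral (a i)) → Integral (∑ a)
  integral-∑ {zero}  int = integral-ι 0ℤ
  integral-∑ {suc n} int = integral-+ (int fzero) (integral-∑ (int ∘ fsuc))

  -- Written as the image of an integer, so that it agrees by computation with the coordinates of
  -- `standardVertex` and is integral at once.
  δ : ∀ {n} → Fin n → Fin n → Carrier
  δ i j = ι (if does (i ≟ j) then 1ℤ else 0ℤ)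

  integral-δ : ∀ {n} (i j : Fin n) → Integral (δ i j)
  integral-δ i j = integral-ι (if does (i ≟ j) then 1ℤ else 0ℤ)

  δ-refl : ∀ {n} (i : Fin n) → δ i i ≈ 1#
  δ-refl i rewrite dec-true (i ≟ i) ≡.refl = ι-1

  δ-≢ : ∀ {n} {i j : Fin n} → i ≢ j → δ i j ≈ 0#
  δ-≢ {i = i} {j} i≢j rewrite dec-false (i ≟ j) i≢j = refl

  δ-sym : ∀ {n} (i j : Fin n) → δ i j ≈ δ j i
  δ-sym fzero    fzero    = refl
  δ-sym fzero    (fsuc j) = refl
  δ-sym (fsuc i) fzero    = refl
  δ-sym (fsuc i) (fsuc j) = δ-sym i j

  δ≈δℕ : ∀ {n} (i j : Fin n) → δ i j ≈ ι (+ δℕ i j)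
  δ≈δℕ i j with does (i ≟ j)
  ... | true  = refl
  ... | false = refl

  0≤δ : ∀ {n} (i j : Fin n) → 0# ≤ δ i j
  0≤δ i j = ≤-respʳ-≈ (sym (δ≈δℕ i j)) (0≤ι+ (δℕ i j))

  ∑-zero : ∀ {n} {a : Vector Carrier n} → (∀ i → a i ≈ 0#) → ∑ a ≈ 0#
  ∑-zero {n} a≈0 = trans (sum-cong-≋ a≈0) (sum-replicate-zero n)

  ∑-congˡ : ∀ {n} (a : Vector Carrier n) {b c : Vector Carrier n} → (∀ i → b i ≈ c i) →
    ∑ (λ i → a i * b i) ≈ ∑ (λ i → a i * c i)
  ∑-congˡ a b≈c = sum-cong-≋ (λ i → *-congˡ (b≈c i))

  ∑-congʳ : ∀ {n} (c : Vector Carrier n) {a b : Vector Carrier n} → (∀ i → a i ≈ b i) →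
    ∑ (λ i → a i * c i) ≈ ∑ (λ i → b i * c i)
  ∑-congʳ c a≈b = sum-cong-≋ (λ i → *-congʳ (a≈b i))

  ∑-neg : ∀ {n} (a : Vector Carrier n) → ∑ (λ i → - a i) ≈ - ∑ a
  ∑-neg {zero}  a = sym -0#≈0#
  ∑-neg {suc n} a = trans (+-congˡ (∑-neg (a ∘ fsuc))) (-‿+-comm (a fzero) _)

  ∑-sub : ∀ {n} (a b : Vector Carrier n) → ∑ (λ i → a i - b i) ≈ ∑ a - ∑ b
  ∑-sub a b = trans (∑-distrib-+ a (λ i → - b i)) (+-congˡ (∑-neg b))

  ∑-δˡ : ∀ {n} (j : Fin n) (a : Vector Carrier n) → ∑ (λ i → δ j i * a i) ≈ a j
  ∑-δˡ fzero    a = begin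
    ι 1ℤ * a fzero + ∑ (λ i → 0# * a (fsuc i)) ≈⟨ +-cong (*-congʳ ι-1) (∑-zero {a = λ i → 0# * a (fsuc i)} (λ i → zeroˡ _)) ⟩
    1# * a fzero + 0#                          ≈⟨ +-identityʳ _ ⟩
    1# * a fzero                               ≈⟨ *-identityˡ _ ⟩
    a fzero                                    ∎
  ∑-δˡ (fsuc j) a = trans (+-cong (zeroˡ _) (∑-δˡ j (a ∘ fsuc))) (+-identityˡ _)

  ∑-δʳ : ∀ {n} (a : Vector Carrier n) (j : Fin n) → ∑ (λ i → a i * δ i j) ≈ a j
  ∑-δʳ a j = trans (sum-cong-≋ (λ i → trans (*-comm (a i) (δ i j)) (*-congʳ (δ-sym i j)))) (∑-δˡ j a)

  ∑-δ : ∀ {n} (j : Fin n) → ∑ (δ j) ≈ 1#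
  ∑-δ j = trans (sum-cong-≋ (λ i → sym (*-identityʳ (δ j i)))) (∑-δˡ j (λ _ → 1#))

  -- Associativity of row times matrix times column.
  ∑-assoc-swap : ∀ {m n} (a : Vector Carrier m) (p : Fin m → Fin n → Carrier) (b : Vector Carrier n) →
    ∑ (λ j → ∑ (λ i → a i * p i j) * b j) ≈ ∑ (λ i → a i * ∑ (λ j → p i j * b j))
  ∑-assoc-swap a p b = begin
    ∑ (λ j → ∑ (λ i → a i * p i j) * b j)   ≈⟨ sum-cong-≋ (λ j → *-distribʳ-sum (b j) (λ i → a i * p i j)) ⟩
    ∑ (λ j → ∑ (λ i → a i * p i j * b j))   ≈⟨ ∑-comm (λ j i → a i * p i j * b j) ⟩
    ∑ (λ i → ∑ (λ j → a i * p i j * b j))   ≈⟨ sum-cong-≋ (λ i → sum-cong-≋ (λ j → *-assoc (a i) (p i j) (b j))) ⟩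
    ∑ (λ i → ∑ (λ j → a i * (p i j * b j))) ≈⟨ sum-cong-≋ (λ i → *-distribˡ-sum (a i) (λ j → p i j * b j)) ⟨
    ∑ (λ i → a i * ∑ (λ j → p i j * b j))   ∎

  -- Pushforward of weights: `c` receives the total weight of its fibre. On barycentric coordinates
  -- this is the action of an affine map sending vertex `i` to vertex `σ i`.
  push : ∀ {n m} → (Fin n → Fin m) → Vector Carrier n → Vector Carrier m
  push σ a c = ∑ (λ i → a i * δ (σ i) c)

  ∑-push-* : ∀ {n m} (σ : Fin n → Fin m) (a : Vector Carrier n) (b : Vector Carrier m) →
    ∑ (λ c → push σ a c * b c) ≈ ∑ (λ i → a i * b (σ i))
  ∑-push-* σ a b = trans (∑-assoc-swap a (λ i c → δ (σ i) c) b)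
    (∑-congˡ a (λ i → ∑-δˡ (σ i) b))

  ∑-push : ∀ {n m} (σ : Fin n → Fin m) (a : Vector Carrier n) → ∑ (push σ a) ≈ ∑ a
  ∑-push σ a = trans (sum-cong-≋ (λ c → sym (*-identityʳ (push σ a c))))
    (trans (∑-push-* σ a (λ _ → 1#)) (sum-cong-≋ (λ i → *-identityʳ (a i))))

  push-nonNegative : ∀ {n m} (σ : Fin n → Fin m) {a : Vector Carrier n} →
    (∀ i → 0# ≤ a i) → ∀ c → 0# ≤ push σ a c
  push-nonNegative σ 0≤a c = ∑-nonNegative (λ i → *-nonNegative (0≤a i) (0≤δ (σ i) c))

  -- An empty fibre would carry an empty weight; this is how vertices of the target are seen to be
  -- hit.
  push-nonzero : ∀ {n m} (σ : Fin n → Fin m) (a : Vector Carrier n) c →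
    ¬ (push σ a c ≈ 0#) → ∃[ i ] σ i ≡ c
  push-nonzero σ a c ≉0 with any? (λ i → σ i ≟ c)
  ... | yes found = found
  ... | no  none  = ⊥-elim (≉0 (∑-zero {a = λ i → a i * δ (σ i) c}
    (λ i → trans (*-congˡ (δ-≢ (λ σi≡c → none (i , σi≡c)))) (zeroʳ (a i)))))

  -- Barycentric coordinates have one entry more than affine ones. The total recovers entry `fzero`,
  -- which belongs to the origin.
  head≈∑-tail : ∀ {n} (a : Vector Carrier (suc n)) → a fzero ≈ ∑ a - ∑ (a ∘ fsuc)
  head≈∑-tail a = sym (trans (+-assoc _ _ _) (trans (+-congˡ (-‿inverseʳ _)) (+-identityʳ _)))

  ≈-from-tail : ∀ {n} (a b : Vector Carrier (suc n)) → ∑ a ≈ ∑ b →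
    (∀ j → a (fsuc j) ≈ b (fsuc j)) → ∀ i → a i ≈ b i
  ≈-from-tail a b ∑≈ tail≈ fzero    = trans (head≈∑-tail a)
    (trans (+-cong ∑≈ (-‿cong (sum-cong-≋ tail≈))) (sym (head≈∑-tail b)))
  ≈-from-tail a b ∑≈ tail≈ (fsuc j) = tail≈ j

  integral-from-tail : ∀ {n} (a : Vector Carrier (suc n)) → Integral (∑ a) →
    (∀ j → Integral (a (fsuc j))) → ∀ i → Integral (a i)
  integral-from-tail a ∑int int fzero    = integral-resp (head≈∑-tail a) (integral-- ∑int (integral-∑ int))
  integral-from-tail a ∑int int (fsuc j) = int j

  integral-unit : ∀ {n} (a : Vector Carrier n) → (∀ i → Integral (a i)) → (∀ i → 0# ≤ a i) →
    ∑ a ≈ 1# → ∃[ i ] (∀ j → a j ≈ δ i j)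
  integral-unit a int 0≤a ∑a≈1 =
    let natural i = ι-nonNegative⁻¹ (proj₁ (int i)) (≤-respʳ-≈ (proj₂ (int i)) (0≤a i))
        n i = proj₁ (natural i)
        a≈n i = trans (proj₂ (int i)) (reflexive (≡.cong ι (proj₂ (natural i))))
        ∑n≡1 = ℤ.+-injective (ι-injective {+ ∑ℕ n} {1ℤ}
          (trans (ι-∑ℕ n) (trans (sum-cong-≋ (λ i → sym (a≈n i))) (trans ∑a≈1 (sym ι-1)))))
        (i , unit) = ∑ℕ≡1⇒unit n ∑n≡1
    in i , λ j → trans (a≈n j) (trans (reflexive (≡.cong (λ k → ι (+ k)) (unit j))) (sym (δ≈δℕ i j)))

  -- The standard simplex and affine lattice maps.

  standardVertex-δ : ∀ {k} (c : Fin (suc k)) j → embed K (standardVertex c) j ≈ δ c (fsuc j)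
  standardVertex-δ fzero    j = refl
  standardVertex-δ (fsuc c) j = refl

  combination-standard : ∀ {k} (b : Vector Carrier (suc k)) j →
    combination K b (λ c → embed K (standardVertex c)) j ≈ b (fsuc j)
  combination-standard b j =
    trans (∑-congˡ b (λ c → standardVertex-δ c j)) (∑-δʳ b (fsuc j))

  combination-cong : ∀ {n d} (a : Vector Carrier n) {p q : Fin n → Space K d} →
    (∀ i → _≋_ K (p i) (q i)) → _≋_ K (combination K a p) (combination K a q)
  combination-cong a p≋q j = ∑-congˡ a (λ i → p≋q i j)

  conv-vertex : ∀ {n d} (p : Fin n → Space K d) i → conv K p (p i)
  conv-vertex p i = δ i , 0≤δ i , ∑-δ i , λ j → ∑-δˡ i (λ i → p i j)

  latticePoint-standard : ∀ {k} (u : Lattice k) (q : Space K k) → _≋_ K q (embed K u) →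
    conv K (λ c → embed K (standardVertex c)) q → ∃[ c ] (∀ j → q j ≈ δ c (fsuc j))
  latticePoint-standard {k} u q q≋u (b , 0≤b , ∑b≈1 , b≋q) =
    proj₁ unit , λ j → trans (sym (tail≈ j)) (proj₂ unit (fsuc j))
    where
    tail≈ : ∀ j → b (fsuc j) ≈ q j
    tail≈ j = trans (sym (combination-standard b j)) (b≋q j)
    unit : ∃[ c ] (∀ c′ → b c′ ≈ δ c c′)
    unit = integral-unit b
      (integral-from-tail b (1ℤ , trans ∑b≈1 (sym ι-1)) (λ j → u j , trans (tail≈ j) (q≋u j)))
      0≤b ∑b≈1

  onSpace-cong : ∀ {d k} (f : AffineLatticeMap d k) {p q : Space K d} →
    _≋_ K p q → _≋_ K (onSpace K f p) (onSpace K f q)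
  onSpace-cong f p≋q j = +-congʳ (sum-cong-≋ (λ l → *-congˡ (p≋q l)))

  onSpace-embed : ∀ {d k} (f : AffineLatticeMap d k) (u : Lattice d) →
    _≋_ K (onSpace K f (embed K u)) (embed K (AffineLatticeMap.onLattice f u))
  onSpace-embed f u j = sym (trans (ι-+ (∑ℤ (λ l → matrix j l ℤ.* u l)) (translation j))
    (+-congʳ (trans (ι-∑ (λ l → matrix j l ℤ.* u l)) (sum-cong-≋ (λ l → ι-* (matrix j l) (u l))))))
    where open AffineLatticeMap f

  -- The total weight is kept general because elements of Λ have integral total rather than total 1;
  -- the translation is then counted `∑ a` times.
  combination-onSpace : ∀ {n d k} (f : AffineLatticeMap d k) (a : Vector Carrier n) (p : Fin n → Space K d) j →
    let open AffineLatticeMap f in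
    combination K a (λ i → onSpace K f (p i)) j ≈
      ∑ (λ l → ι (matrix j l) * combination K a p l) + ι (translation j) * ∑ a
  combination-onSpace f a p j = begin
    ∑ (λ i → a i * (∑ (λ l → M l * p i l) + t))
      ≈⟨ sum-cong-≋ (λ i → trans (distribˡ (a i) _ t)
           (+-cong (*-congˡ (sum-cong-≋ (λ l → *-comm (M l) (p i l)))) (*-comm (a i) t))) ⟩
    ∑ (λ i → a i * ∑ (λ l → p i l * M l) + t * a i)
      ≈⟨ ∑-distrib-+ (λ i → a i * ∑ (λ l → p i l * M l)) (λ i → t * a i) ⟩
    ∑ (λ i → a i * ∑ (λ l → p i l * M l)) + ∑ (λ i → t * a i)
      ≈⟨ +-cong (∑-assoc-swap a p M) (*-distribˡ-sum t a) ⟨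
    ∑ (λ l → combination K a p l * M l) + t * ∑ a
      ≈⟨ +-congʳ (sum-cong-≋ (λ l → *-comm (combination K a p l) (M l))) ⟩
    ∑ (λ l → M l * combination K a p l) + t * ∑ a ∎
    where
    M = λ l → ι (AffineLatticeMap.matrix f j l)
    t = ι (AffineLatticeMap.translation f j)

  onSpace-combination : ∀ {n d k} (f : AffineLatticeMap d k) (a : Vector Carrier n) (p : Fin n → Space K d) →
    ∑ a ≈ 1# → _≋_ K (onSpace K f (combination K a p)) (combination K a (λ i → onSpace K f (p i)))
  onSpace-combination f a p ∑a≈1 j = sym (trans (combination-onSpace f a p j)
    (+-congˡ (trans (*-congˡ ∑a≈1) (*-identityʳ _))))

  module VertexMap {n d k} (f : AffineLatticeMap d k) (v : Fin n → Space K d) (σ : Fin n → Fin (suc k))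
    (f-vertex : ∀ i → _≋_ K (onSpace K f (v i)) (embed K (standardVertex (σ i)))) where

    std : Fin (suc k) → Space K k
    std c = embed K (standardVertex c)

    combination-push : ∀ a → _≋_ K (combination K (push σ a) std) (combination K a (λ i → onSpace K f (v i)))
    combination-push a j = trans (∑-push-* σ a (λ c → std c j)) (combination-cong a (λ i j → sym (f-vertex i j)) j)

    f-combination : ∀ a → ∑ a ≈ 1# →
      _≋_ K (combination K (push σ a) std) (onSpace K f (combination K a v))
    f-combination a ∑a≈1 j = trans (combination-push a j) (sym (onSpace-combination f a v ∑a≈1 j))

    into : ∀ p → conv K v p → conv K std (onSpace K f p)
    into p (a , 0≤a , ∑a≈1 , a≋p) =
      push σ a , push-nonNegative σ 0≤a , trans (∑-push σ a) ∑a≈1 ,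
      λ j → trans (f-combination a ∑a≈1 j) (onSpace-cong f a≋p j)

    -- Entries other than `fzero` come from an integer matrix and translation applied to integral
    -- data; entry `fzero` follows from the integral total.
    integral-push : ∀ a → (∀ l → Integral (combination K a v l)) → Integral (∑ a) → ∀ c → Integral (push σ a c)
    integral-push a int ∑int = integral-from-tail (push σ a) (integral-resp (∑-push σ a) ∑int) λ j →
      integral-resp
        (trans (sym (combination-standard (push σ a) j)) (trans (combination-push a j) (combination-onSpace f a v j)))
        (integral-+
          (integral-∑ (λ l → integral-* (integral-ι (matrix j l)) (int l)))
          (integral-* (integral-ι (translation j)) ∑int))
      where open AffineLatticeMap f

    -- The weights of a preimage of vertex `c` push forward to `δ c`, whose entry at `c` is 1, so
    -- the fibre of `c` is inhabited.
    vertex-hit : ∀ c p → conv K v p → _≋_ K (onSpace K f p) (std c) → ∃[ i ] σ i ≡ c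
    vertex-hit c p (a , _ , ∑a≈1 , a≋p) fp≋c = push-nonzero σ a c
      (λ ≈0 → 0≉1 (trans (sym ≈0) (trans (push≈δ c) (δ-refl c))))
      where
      tail≈ : ∀ j → push σ a (fsuc j) ≈ δ c (fsuc j)
      tail≈ j = begin
        push σ a (fsuc j)                  ≈⟨ combination-standard (push σ a) j ⟨
        combination K (push σ a) std j     ≈⟨ f-combination a ∑a≈1 j ⟩
        onSpace K f (combination K a v) j  ≈⟨ onSpace-cong f a≋p j ⟩
        onSpace K f p j                    ≈⟨ fp≋c j ⟩
        std c j                            ≈⟨ standardVertex-δ c j ⟩
        δ c (fsuc j)                       ∎
      push≈δ : ∀ c′ → push σ a c′ ≈ δ c c′
      push≈δ = ≈-from-tail (push σ a) (δ c) (trans (∑-push σ a) (trans ∑a≈1 (sym (∑-δ c)))) tail≈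

    module Section (τ : Fin (suc k) → Fin n) (σ∘τ : ∀ c → σ (τ c) ≡ c) where

      f-section : ∀ b → ∑ b ≈ 1# → ∀ j → onSpace K f (combination K (push τ b) v) j ≈ b (fsuc j)
      f-section b ∑b≈1 j = begin
        onSpace K f (combination K (push τ b) v) j
          ≈⟨ f-combination (push τ b) (trans (∑-push τ b) ∑b≈1) j ⟨
        combination K (push σ (push τ b)) std j
          ≈⟨ combination-standard (push σ (push τ b)) j ⟩
        push σ (push τ b) (fsuc j)
          ≈⟨ ∑-push-* τ b (λ i → δ (σ i) (fsuc j)) ⟩
        ∑ (λ c → b c * δ (σ (τ c)) (fsuc j))
          ≡⟨ sum-cong-≗ (λ c → ≡.cong (λ c′ → b c * δ c′ (fsuc j)) (σ∘τ c)) ⟩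
        ∑ (λ c → b c * δ c (fsuc j))
          ≈⟨ ∑-δʳ b (fsuc j) ⟩
        b (fsuc j) ∎

      onto : ∀ q → conv K std q → Σ[ p ∈ Space K d ] conv K v p × _≋_ K (onSpace K f p) q
      onto q (b , 0≤b , ∑b≈1 , b≋q) = combination K (push τ b) v ,
        (push τ b , push-nonNegative τ 0≤b , trans (∑-push τ b) ∑b≈1 , λ _ → refl) ,
        λ j → trans (f-section b ∑b≈1 j) (trans (sym (combination-standard b j)) (b≋q j))

  section⇒latticeProjection : ∀ {n d k} (f : AffineLatticeMap d k) (v : Fin n → Lattice d) (τ : Fin (suc k) → Fin n) →
    (∀ b → ∑ b ≈ 1# → ∀ j → onSpace K f (combination K (push τ b) (λ i → embed K (v i))) j ≈ b (fsuc j)) →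
    IsLatticeProjection f
  section⇒latticeProjection {k = k} f v τ f-section w = u , λ j → ι-injective (begin
    ι (onLattice u j)
      ≈⟨ onSpace-embed f u j ⟨
    onSpace K f (embed K u) j
      ≈⟨ onSpace-cong f u≋ j ⟩
    onSpace K f (combination K (push τ (ι ∘ b)) (λ i → embed K (v i))) j
      ≈⟨ f-section (ι ∘ b) ∑b≈1 j ⟩
    ι (w j) ∎)
    where
    open AffineLatticeMap f
    -- The entry at the origin forces total 1. It may be negative, so the lattice point `u` may lie
    -- outside the hull of the `v i`.
    b : Vector ℤ (suc k)
    b = (1ℤ ℤ.- ∑ℤ w) Vector.∷ w
    u : Lattice _
    u l = ∑ℤ (λ c → b c ℤ.* v (τ c) l)
    sub-add : ∀ x y → x ℤ.- y ℤ.+ y ≡ x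
    sub-add = solve-∀
    ∑b≈1 : ∑ (ι ∘ b) ≈ 1#
    ∑b≈1 = begin
      ∑ (ι ∘ b)                  ≈⟨ ι-∑ b ⟨
      ι (1ℤ ℤ.- ∑ℤ w ℤ.+ ∑ℤ w)   ≡⟨ ≡.cong ι (sub-add 1ℤ (∑ℤ w)) ⟩
      ι 1ℤ                       ≈⟨ ι-1 ⟩
      1#                         ∎
    u≋ : _≋_ K (embed K u) (combination K (push τ (ι ∘ b)) (λ i → embed K (v i)))
    u≋ l = begin
      ι (u l)                                                  ≈⟨ ι-∑ (λ c → b c ℤ.* v (τ c) l) ⟩
      ∑ (λ c → ι (b c ℤ.* v (τ c) l))                          ≈⟨ sum-cong-≋ (λ c → ι-* (b c) (v (τ c) l)) ⟩
      ∑ (λ c → ι (b c) * ι (v (τ c) l))                        ≈⟨ ∑-push-* τ (ι ∘ b) (λ i → ι (v i l)) ⟨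
      combination K (push τ (ι ∘ b)) (λ i → embed K (v i)) l   ∎

  -- Integrality of weights and divisibility of letter sums.

  integral-scaled⇒∣ : ∀ N {s k} → ι (+ N) * s ≈ ι (+ k) → Integral s → N ∣ k
  integral-scaled⇒∣ N {s} {k} Ns≈k (z , s≈z) = divides ∣ z ∣ (≡.trans
    (≡.cong ∣_∣ (ι-injective {+ k} {+ N ℤ.* z} (trans (sym Ns≈k) (trans (*-congˡ s≈z) (sym (ι-* (+ N) z))))))
    (≡.trans (ℤ.abs-* (+ N) z) (ℕ.*-comm N ∣ z ∣)))

  ∣⇒integral-scaled : ∀ N .{{_ : NonZero N}} {s k} → ι (+ N) * s ≈ ι (+ k) → N ∣ k → Integral s
  ∣⇒integral-scaled N {s} Ns≈k (divides q ≡.refl) = + q , *-cancelˡ-≈ (ι (+ N)) (ι+≉0 N) (begin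
    ι (+ N) * s         ≈⟨ Ns≈k ⟩
    ι (+ (q ℕ.* N))     ≡⟨ ≡.cong ι (≡.cong +_ (ℕ.*-comm q N)) ⟩
    ι (+ (N ℕ.* q))     ≈⟨ ×1-homo-* N q ⟩
    ι (+ N) * ι (+ q)   ∎)

  -- The bridge between geometry and code: once `N` clears denominators, the weight of a fibre
  -- becomes the sum of the letters over it.
  scaled-push : ∀ N {n m} (σ : Fin n → Fin m) c I (a : Vector Carrier n) (w : Vector ℕ n) →
    (∀ i → lookup I i ≡ does (σ i ≟ c)) → (∀ i → ι (+ N) * a i ≈ ι (+ w i)) →
    ι (+ N) * push σ a c ≈ ι (+ sumOver I w)
  scaled-push N σ c I a w I≡σ⁻¹c Na≈w = begin
    ι (+ N) * push σ a c                         ≈⟨ *-distribˡ-sum (ι (+ N)) (λ i → a i * δ (σ i) c) ⟩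
    ∑ (λ i → ι (+ N) * (a i * δ (σ i) c))        ≈⟨ sum-cong-≋ (λ i → sym (*-assoc (ι (+ N)) (a i) (δ (σ i) c))) ⟩
    ∑ (λ i → ι (+ N) * a i * δ (σ i) c)          ≈⟨ sum-cong-≋ (λ i → *-congʳ (Na≈w i)) ⟩
    ∑ (λ i → ι (+ w i) * δ (σ i) c)              ≈⟨ sum-cong-≋ term ⟩
    ∑ (λ i → ι (+ (if lookup I i then w i else 0))) ≈⟨ ι-∑ℕ (λ i → if lookup I i then w i else 0) ⟨
    ι (+ sumOver I w)                            ∎
    where
    term : ∀ i → ι (+ w i) * δ (σ i) c ≈ ι (+ (if lookup I i then w i else 0))
    term i rewrite I≡σ⁻¹c i with does (σ i ≟ c)
    ... | true  = trans (*-congˡ ι-1) (*-identityʳ _)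
    ... | false = zeroʳ _

  1≤-from-scaled : ∀ N .{{_ : NonZero N}} {x} → ι (+ N) ≤ ι (+ N) * x → 1# ≤ x
  1≤-from-scaled N {x} N≤Nx with total 1# x
  ... | inj₁ 1≤x = 1≤x
  -- Here `N x` is squeezed between `N` and `N`, and cancelling `N` gives `x ≈ 1`.
  ... | inj₂ x≤1 = ≤-respʳ-≈ (*-cancelˡ-≈ (ι (+ N)) (ι+≉0 N)
      (trans (*-identityʳ _) (antisym N≤Nx Nx≤N))) ≤-refl
    where
    Nx≤N : ι (+ N) * x ≤ ι (+ N)
    Nx≤N = 0≤-⇒≤ (≤-respʳ-≈ (trans (x[y-z]≈xy-xz _ _ _) (+-congʳ (*-identityʳ _)))
      (*-nonNegative (0≤ι+ N) (≤⇒0≤- x≤1)))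

  -- Letters live in `Fin N`, so the integer `N frac x` must lie between 0 and `N - 1`: it is
  -- nonnegative because `frac x` is, and reaching `N` would force `1 ≤ frac x`.
  letter : ∀ N .{{_ : NonZero N}} x → Integral (ι (+ N) * frac x) →
    Σ[ w ∈ Fin N ] ι (+ N) * frac x ≈ ι (+ toℕ w)
  letter N x (z , Nx≈z) with ι-nonNegative⁻¹ z (≤-respʳ-≈ Nx≈z (*-nonNegative (0≤ι+ N) (0≤frac x)))
  ... | n , ≡.refl with n ℕ.<? N
  ... | yes n<N = fromℕ< n<N , trans Nx≈z (reflexive (≡.cong (λ k → ι (+ k)) (≡.sym (toℕ-fromℕ< n<N))))
  ... | no  n≮N = ⊥-elim (frac<1 x (1≤-from-scaled N (≤-respʳ-≈ (sym Nx≈z) (0≤-⇒≤ (≤-respʳ-≈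
      (trans (reflexive (≡.cong ι (≡.sym (≡.trans (ℤ.m-n≡m⊖n n N) (ℤ.⊖-≥ (ℕ.≮⇒≥ n≮N)))))) (ι-sub (+ n) (+ N)))
      (0≤ι+ (n ℕ.∸ N)))))))

  -- Denominators of elements of the field.

  module _ {d : ℕ} (Δ : LatticeSimplex K d) where
    open LatticeSimplex Δ

    -- `ℚ` is used to bring `b / n` to lowest terms; the factor `g` by which the two fractions
    -- differ is then cancelled inside `K`.
    rational-denominator : ∀ {x} n .{{_ : NonZero n}} b → ι (+ n) * x ≈ ι b → ∃[ q ] IsDenominator K Δ x q
    rational-denominator {x} n b nx≈b = ℚ.↧ₙ r , _ , ℚ.↥ r ,
      *-cancelˡ-≈ (ι g) g≉0 (begin
        ι g * (ι (ℚ.↧ r) * x)   ≈⟨ *-assoc _ _ _ ⟨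
        ι g * ι (ℚ.↧ r) * x     ≈⟨ *-congʳ (*-comm _ _) ⟩
        ι (ℚ.↧ r) * ι g * x     ≈⟨ *-congʳ (ι-* (ℚ.↧ r) g) ⟨
        ι (ℚ.↧ r ℤ.* g) * x     ≡⟨ ≡.cong (λ z → ι z * x) (ℚ.↧-/ b n) ⟩
        ι (+ n) * x             ≈⟨ nx≈b ⟩
        ι b                     ≡⟨ ≡.cong ι (ℚ.↥-/ b n) ⟨
        ι (ℚ.↥ r ℤ.* g)         ≈⟨ ι-* (ℚ.↥ r) g ⟩
        ι (ℚ.↥ r) * ι g         ≈⟨ *-comm _ _ ⟩
        ι g * ι (ℚ.↥ r)         ∎) ,
      reduced-coprime r
      where
      r = b ℚ./ n
      g = ℤ.gcd b (+ n)
      g≉0 : ¬ (ι g ≈ 0#)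
      g≉0 eq = ℕ.≢-nonZero⁻¹ n (ℤ.+-injective (ℤ.gcd[i,j]≡0⇒j≡0 {b} (ι≈0⇒≡0 g eq)))

    rational-denominatorℤ : ∀ {x} D b → D ≢ 0ℤ → ι D * x ≈ ι b → ∃[ q ] IsDenominator K Δ x q
    rational-denominatorℤ (+ zero)  b D≢0 _    = contradiction ≡.refl D≢0
    rational-denominatorℤ (+ suc n) b D≢0 Dx≈b = rational-denominator (suc n) b Dx≈b
    rational-denominatorℤ {x} -[1+ n ] b D≢0 Dx≈b = rational-denominator (suc n) (ℤ.- b) (begin
      ι (+ suc n) * x       ≈⟨ -‿involutive _ ⟨
      - - (ι (+ suc n) * x) ≈⟨ -‿cong (trans (-‿distribˡ-* _ _) Dx≈b) ⟩
      - ι b                 ≈⟨ ι-neg b ⟨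
      ι (ℤ.- b)             ∎)

    -- Comparing the two fractions for `x` gives `p N = b q`, and `q` is coprime to `p`.
    denominator-∣ : ∀ {x q} N → IsDenominator K Δ x q → Integral (ι (+ N) * x) → q ∣ N
    denominator-∣ {x} {q} N (q≢0 , p , qx≈p , p⊥q) (b , Nx≈b) =
      coprime-divisor (Coprimality.sym p⊥q) (divides ∣ b ∣ (≡.trans (≡.sym (ℤ.abs-* p (+ N)))
        (≡.trans (≡.cong ∣_∣ pN≡bq) (ℤ.abs-* b (+ q)))))
      where
      pN≡bq : p ℤ.* + N ≡ b ℤ.* + q
      pN≡bq = ι-injective (begin
        ι (p ℤ.* + N)           ≈⟨ ι-* p (+ N) ⟩
        ι p * ι (+ N)           ≈⟨ *-congʳ qx≈p ⟨
        ι (+ q) * x * ι (+ N)   ≈⟨ *-comm _ _ ⟩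
        ι (+ N) * (ι (+ q) * x) ≈⟨ *-congˡ (*-comm _ _) ⟩
        ι (+ N) * (x * ι (+ q)) ≈⟨ *-assoc _ _ _ ⟨
        ι (+ N) * x * ι (+ q)   ≈⟨ *-congʳ Nx≈b ⟩
        ι b * ι (+ q)           ≈⟨ ι-* b (+ q) ⟨
        ι (b ℤ.* + q)           ∎)

    integral-denominator : ∀ {x q} N → IsDenominator K Δ x q → q ∣ N → Integral (ι (+ N) * x)
    integral-denominator {x} {q} _ (_ , p , qx≈p , _) (divides k ≡.refl) =
      integral-resp (trans (*-congʳ (×1-homo-* k q)) (*-assoc _ _ _))
        (integral-* (integral-ι (+ k)) (p , qx≈p))

    frac-denominator : ∀ {x q} → IsDenominator K Δ x q → IsDenominator K Δ (frac x) q
    frac-denominator {x} {q} (q≢0 , p , qx≈p , p⊥q) = q≢0 , p ℤ.- + q ℤ.* floor x ,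
      (begin
        ι (+ q) * (x - ι (floor x))             ≈⟨ x[y-z]≈xy-xz _ _ _ ⟩
        ι (+ q) * x - ι (+ q) * ι (floor x)     ≈⟨ +-cong qx≈p (-‿cong (sym (ι-* (+ q) (floor x)))) ⟩
        ι p - ι (+ q ℤ.* floor x)               ≈⟨ ι-sub p (+ q ℤ.* floor x) ⟨
        ι (p ℤ.- + q ℤ.* floor x)               ∎) ,
      coprime-sub p q (floor x) p⊥q

    -- The homogeneous vertex matrix and its inverse.

    homogeneous : Fin (suc d) → Lattice (suc d)
    homogeneous i fzero    = 1ℤ
    homogeneous i (fsuc l) = vertex i l

    A : Fin (suc d) → Fin (suc d) → Carrier
    A i l = ι (homogeneous i l)

    ∑-A-0 : ∀ a → ∑ (λ i → a i * A i fzero) ≈ ∑ a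
    ∑-A-0 a = sum-cong-≋ (λ i → trans (*-congˡ ι-1) (*-identityʳ (a i)))

    -- Column `fzero` of `A` is constantly 1, so a vanishing product `a A` includes the zero total
    -- that affine independence asks for.
    A-independent : ∀ a → (∀ l → ∑ (λ i → a i * A i l) ≈ 0#) → ∀ i → a i ≈ 0#
    A-independent a aA≈0 = affinelyIndependent a (trans (sym (∑-A-0 a)) (aA≈0 fzero)) (aA≈0 ∘ fsuc)

    -- d + 2 vectors in ℤ^(d+1), namely e_l and the rows of A, satisfy a relation;
    -- independence of the rows forces e_l to occur in it.
    inverseRow : ∀ l → Σ[ x ∈ Vector Carrier (suc d) ]
      (∀ l′ → ∑ (λ i → x i * A i l′) ≈ δ l l′) × (∀ i → ∃[ q ] IsDenominator K Δ (x i) q)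
    inverseRow l = x , xA≈δ , λ i → rational-denominatorℤ D (b i) D≢0 (Dx≈b i)
      where
      e : Lattice (suc d)
      e l′ = if does (l ≟ l′) then 1ℤ else 0ℤ
      relation = linearRelation (suc d) (e Vector.∷ homogeneous)
      coefficient = proj₁ relation
      -- Moving the `e` term across, the rows of `A` with coefficients `b` combine to `D e`, so
      -- `b / D` is row `l` of the inverse.
      D = ℤ.- coefficient fzero
      b = coefficient ∘ fsuc
      relation-K : ∀ l′ → ι (coefficient fzero) * δ l l′ + ∑ (λ i → ι (b i) * A i l′) ≈ 0#
      relation-K l′ = begin
        ι (coefficient fzero) * δ l l′ + ∑ (λ i → ι (b i) * A i l′)
          ≈⟨ +-cong (ι-* (coefficient fzero) (e l′)) (sum-cong-≋ (λ i → ι-* (b i) (homogeneous i l′))) ⟨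
        ∑ (λ i → ι (coefficient i ℤ.* (e Vector.∷ homogeneous) i l′))
          ≈⟨ ι-∑ (λ i → coefficient i ℤ.* (e Vector.∷ homogeneous) i l′) ⟨
        ι (∑ℤ (λ i → coefficient i ℤ.* (e Vector.∷ homogeneous) i l′))
          ≡⟨ ≡.cong ι (proj₂ (proj₂ relation) l′) ⟩
        0# ∎
      c₀≢0 : coefficient fzero ≢ 0ℤ
      c₀≢0 c₀≡0 with proj₁ (proj₂ relation)
      ... | fzero  , c≢0 = c≢0 c₀≡0
      ... | fsuc i , c≢0 = c≢0 (ι≈0⇒≡0 (b i) (A-independent (ι ∘ b)
        (λ l′ → trans (sym (trans (+-congʳ (trans (*-congʳ (reflexive (≡.cong ι c₀≡0))) (zeroˡ _)))
          (+-identityˡ _))) (relation-K l′)) i))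
      D≢0 : D ≢ 0ℤ
      D≢0 = c₀≢0 ∘ ℤ.neg-injective {coefficient fzero} {0ℤ}
      D≉0 : ¬ (ι D ≈ 0#)
      D≉0 = D≢0 ∘ ι≈0⇒≡0 D
      D⁻¹ = inverse (ι D) D≉0
      x = λ i → proj₁ D⁻¹ * ι (b i)
      Dx≈b : ∀ i → ι D * x i ≈ ι (b i)
      Dx≈b i = trans (sym (*-assoc _ _ _)) (trans (*-congʳ (proj₂ D⁻¹)) (*-identityˡ _))
      xA≈δ : ∀ l′ → ∑ (λ i → x i * A i l′) ≈ δ l l′
      xA≈δ l′ = *-cancelˡ-≈ (ι D) D≉0 (begin
        ι D * ∑ (λ i → x i * A i l′)       ≈⟨ *-distribˡ-sum (ι D) (λ i → x i * A i l′) ⟩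
        ∑ (λ i → ι D * (x i * A i l′))     ≈⟨ sum-cong-≋ (λ i → trans (sym (*-assoc (ι D) (x i) (A i l′))) (*-congʳ (Dx≈b i))) ⟩
        ∑ (λ i → ι (b i) * A i l′)         ≈⟨ +-inverseʳ-unique _ _ (relation-K l′) ⟩
        - (ι (coefficient fzero) * δ l l′) ≈⟨ -‿distribˡ-* _ _ ⟩
        - ι (coefficient fzero) * δ l l′   ≈⟨ *-congʳ (ι-neg (coefficient fzero)) ⟨
        ι D * δ l l′                       ∎)

    A⁻¹ : Fin (suc d) → Fin (suc d) → Carrier
    A⁻¹ l = proj₁ (inverseRow l)

    A⁻¹-inverseˡ : ∀ l l′ → ∑ (λ i → A⁻¹ l i * A i l′) ≈ δ l l′
    A⁻¹-inverseˡ l = proj₁ (proj₂ (inverseRow l))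

    -- The left inverse gives `(A A⁻¹ - I) A = 0`, and independence of the rows of `A` cancels the
    -- right factor.
    A⁻¹-inverseʳ : ∀ i i′ → ∑ (λ l → A i l * A⁻¹ l i′) ≈ δ i i′
    A⁻¹-inverseʳ i i′ = x∙y⁻¹≈ε⇒x≈y _ _ (A-independent (λ i′ → AA⁻¹ i′ - δ i i′) vanishes i′)
      where
      AA⁻¹ = λ i′ → ∑ (λ l → A i l * A⁻¹ l i′)
      vanishes : ∀ l → ∑ (λ i′ → (AA⁻¹ i′ - δ i i′) * A i′ l) ≈ 0#
      vanishes l = begin
        ∑ (λ i′ → (AA⁻¹ i′ - δ i i′) * A i′ l)
          ≈⟨ sum-cong-≋ (λ i′ → [y-z]x≈yx-zx (A i′ l) (AA⁻¹ i′) (δ i i′)) ⟩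
        ∑ (λ i′ → AA⁻¹ i′ * A i′ l - δ i i′ * A i′ l)
          ≈⟨ ∑-sub (λ i′ → AA⁻¹ i′ * A i′ l) (λ i′ → δ i i′ * A i′ l) ⟩
        ∑ (λ i′ → AA⁻¹ i′ * A i′ l) - ∑ (λ i′ → δ i i′ * A i′ l)
          ≈⟨ x≈y⇒x∙y⁻¹≈ε (begin
               ∑ (λ i′ → AA⁻¹ i′ * A i′ l)                         ≈⟨ ∑-assoc-swap (A i) A⁻¹ (λ i′ → A i′ l) ⟩
               ∑ (λ l′ → A i l′ * ∑ (λ i′ → A⁻¹ l′ i′ * A i′ l))   ≈⟨ ∑-congˡ (A i) (λ l′ → A⁻¹-inverseˡ l′ l) ⟩
               ∑ (λ l′ → A i l′ * δ l′ l)                          ≈⟨ ∑-δʳ (A i) l ⟩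
               A i l                                               ≈⟨ ∑-δˡ i (λ i′ → A i′ l) ⟨
               ∑ (λ i′ → δ i i′ * A i′ l)                          ∎) ⟩
        0# ∎

    -- The group Λ and the code modulus.

    Λ⇒integral : ∀ x → Λ K Δ x → ∀ l → Integral (∑ (λ i → frac (x i) * A i l))
    Λ⇒integral x (_ , total∈ℤ)  fzero    = integral-resp (∑-A-0 (frac ∘ x)) total∈ℤ
    Λ⇒integral x ((u , ≋u) , _) (fsuc l) = u l , ≋u l

    -- Passing to fractional parts subtracts an integer combination of the rows of `A`, which is
    -- integral.
    integral⇒Λ : ∀ x → (∀ l → Integral (∑ (λ i → x i * A i l))) → Λ K Δ x
    integral⇒Λ x int =
      ((λ l → proj₁ (frac-integral (fsuc l))) , λ l → proj₂ (frac-integral (fsuc l))) ,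
      integral-resp (sym (∑-A-0 (frac ∘ x))) (frac-integral fzero)
      where
      frac-integral : ∀ l → Integral (∑ (λ i → frac (x i) * A i l))
      frac-integral l = integral-resp
        (trans (sum-cong-≋ (λ i → [y-z]x≈yx-zx (A i l) (x i) (ι (floor (x i)))))
          (∑-sub (λ i → x i * A i l) (λ i → ι (floor (x i)) * A i l)))
        (integral-- (int l) (integral-∑ (λ i → integral-* (integral-ι (floor (x i))) (integral-ι (homogeneous i l)))))

    A⁻¹∈Λ : ∀ l → Λ K Δ (A⁻¹ l)
    A⁻¹∈Λ l = integral⇒Λ (A⁻¹ l) (λ l′ → integral-resp (A⁻¹-inverseˡ l l′) (integral-δ l l′))

    -- This is `a = (a A) A⁻¹`. For fractional parts of an element of Λ the coefficients `a A` are
    -- integers, which is why the rows of `A⁻¹` generate.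
    expand-A⁻¹ : ∀ a i → a i ≈ ∑ (λ l → ∑ (λ i → a i * A i l) * A⁻¹ l i)
    expand-A⁻¹ a i = sym (trans (∑-assoc-swap a A (λ l → A⁻¹ l i))
      (trans (∑-congˡ a (λ i′ → A⁻¹-inverseʳ i′ i)) (∑-δʳ a i)))

    denominator : Fin (suc d) → Fin (suc d) → ℕ
    denominator l i = proj₁ (proj₂ (proj₂ (inverseRow l)) i)

    isDenominator : ∀ l i → IsDenominator K Δ (A⁻¹ l i) (denominator l i)
    isDenominator l i = proj₂ (proj₂ (proj₂ (inverseRow l)) i)

    rowModulus : ∀ l → ∃[ N ] NonZero N × (∀ i → denominator l i ∣ N) × (∀ k → (∀ i → denominator l i ∣ k) → N ∣ k)
    rowModulus l = finiteLCM (denominator l) (λ i → proj₁ (isDenominator l i))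

    modulus : ∃[ N ] NonZero N × (∀ l → proj₁ (rowModulus l) ∣ N) × (∀ k → (∀ l → proj₁ (rowModulus l) ∣ k) → N ∣ k)
    modulus = finiteLCM (proj₁ ∘ rowModulus) (proj₁ ∘ proj₂ ∘ rowModulus)

    N : ℕ
    N = proj₁ modulus

    instance
      N≢0 : NonZero N
      N≢0 = proj₁ (proj₂ modulus)

    N*Λ-integral : ∀ x → Λ K Δ x → ∀ i → Integral (ι (+ N) * frac (x i))
    N*Λ-integral x x∈Λ i = integral-resp
      (begin
        ι (+ N) * frac (x i)                  ≈⟨ *-congˡ (expand-A⁻¹ (frac ∘ x) i) ⟩
        ι (+ N) * ∑ (λ l → s l * A⁻¹ l i)     ≈⟨ *-distribˡ-sum (ι (+ N)) (λ l → s l * A⁻¹ l i) ⟩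
        ∑ (λ l → ι (+ N) * (s l * A⁻¹ l i))   ≈⟨ sum-cong-≋ (λ l → *-swap (ι (+ N)) (s l) (A⁻¹ l i)) ⟩
        ∑ (λ l → s l * (ι (+ N) * A⁻¹ l i))   ∎)
      (integral-∑ (λ l → integral-* (Λ⇒integral x x∈Λ l) (integral-denominator N (isDenominator l i)
        (∣-trans (proj₁ (proj₂ (proj₂ (rowModulus l))) i) (proj₁ (proj₂ (proj₂ modulus)) l)))))
      where s = λ l → ∑ (λ i → frac (x i) * A i l)

    -- An upper bound because `N` clears the generators; least because each denominator entering `N`
    -- is attained by `frac` of an entry of a row of `A⁻¹`, itself an element of Λ.
    N-isCodeModulus : IsCodeModulus K Δ N
    N-isCodeModulus =
      (λ q (x , x∈Λ , i , q-den) → denominator-∣ N q-den (N*Λ-integral x x∈Λ i)) ,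
      λ k q∣k → proj₂ (proj₂ (proj₂ modulus)) k (λ l → proj₂ (proj₂ (proj₂ (rowModulus l))) k
        (λ i → q∣k _ (A⁻¹ l , A⁻¹∈Λ l , i , frac-denominator (isDenominator l i))))

    -- From Cayley projections to splittings.

    cayley⇒splits : ∀ k → IsCayleyOfLength K Δ (suc k) → SplitsInto (suc k) (simplexCode K Δ N)
    cayley⇒splits k (f , _ , into , onto) = partition , divisible
      where
      open AffineLatticeMap f
      v = λ i → embed K (vertex i)

      vertexImage : ∀ i → ∃[ c ] (∀ j → onSpace K f (v i) j ≈ δ c (fsuc j))
      vertexImage i = latticePoint-standard (onLattice (vertex i)) (onSpace K f (v i))
        (onSpace-embed f (vertex i)) (into (v i) (conv-vertex v i))

      σ : Fin (suc d) → Fin (suc k)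
      σ i = proj₁ (vertexImage i)

      open VertexMap f v σ (λ i j → trans (proj₂ (vertexImage i) j) (sym (standardVertex-δ (σ i) j)))
        using (std; vertex-hit; integral-push)

      -- Each standard vertex has a preimage in the simplex; this makes the parts nonempty.
      σ-surjective : ∀ c → ∃[ i ] σ i ≡ c
      σ-surjective c = let (p , p∈Δ , fp≋c) = onto (std c) (conv-vertex std c) in vertex-hit c p p∈Δ fp≋c

      open FibrePartition σ σ-surjective

      divisible : ∀ c w → simplexCode K Δ N w → N ∣ sumOver (fibre c) (λ i → toℕ (w i))
      divisible c w (x , ((u , ≋u) , ∑∈ℤ) , Nx≈w) = integral-scaled⇒∣ N
        (scaled-push N σ c (fibre c) (frac ∘ x) (λ i → toℕ (w i)) (lookup-fibre c) Nx≈w)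
        (integral-push (frac ∘ x) (λ l → u l , ≋u l) ∑∈ℤ c)

    -- From splittings to Cayley projections.

    splits⇒cayley : ∀ k → SplitsInto (suc k) (simplexCode K Δ N) → IsCayleyOfLength K Δ (suc k)
    splits⇒cayley k (P , divisible) = f , section⇒latticeProjection f vertex representative f-section , into , onto
      where
      open PartitionMap P
      v = λ i → embed K (vertex i)

      word : ∀ l → Word N (suc d)
      word l i = proj₁ (letter N (A⁻¹ l i) (N*Λ-integral (A⁻¹ l) (A⁻¹∈Λ l) i))

      N*A⁻¹≈word : ∀ l i → ι (+ N) * frac (A⁻¹ l i) ≈ ι (+ toℕ (word l i))
      N*A⁻¹≈word l i = proj₂ (letter N (A⁻¹ l i) (N*Λ-integral (A⁻¹ l) (A⁻¹∈Λ l) i))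

      -- The splitting condition controls the fractional parts of row `l` through the word they
      -- spell; the floors add integers to every fibre sum.
      push-A⁻¹-integral : ∀ c l → Integral (push σ (A⁻¹ l) c)
      push-A⁻¹-integral c l = integral-resp
        (trans (sum-cong-≋ (λ i → trans (*-congʳ (sym (frac+floor (A⁻¹ l i))))
          (distribʳ (δ (σ i) c) (frac (A⁻¹ l i)) (ι (floor (A⁻¹ l i))))))
          (∑-distrib-+ (λ i → frac (A⁻¹ l i) * δ (σ i) c) (λ i → ι (floor (A⁻¹ l i)) * δ (σ i) c)))
        (integral-+
          (∣⇒integral-scaled N
            (scaled-push N σ c (part c) (frac ∘ A⁻¹ l) (λ i → toℕ (word l i)) (lookup-part c) (N*A⁻¹≈word l))
            (divisible c (word l) (A⁻¹ l , A⁻¹∈Λ l , N*A⁻¹≈word l)))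
          (integral-∑ (λ i → integral-* (integral-ι (floor (A⁻¹ l i))) (integral-δ (σ i) c))))

      -- `φ c` is an integer affine form, with constant term at index `fzero`, whose value at vertex
      -- `i` is `δ (σ i) c`: a barycentric coordinate pulled back from the standard simplex.
      φ : Fin (suc k) → Lattice (suc d)
      φ c l = proj₁ (push-A⁻¹-integral c l)

      A*φ : ∀ i c → ∑ (λ l → A i l * ι (φ c l)) ≈ δ (σ i) c
      A*φ i c = begin
        ∑ (λ l → A i l * ι (φ c l))                                  ≈⟨ ∑-congˡ (A i) (λ l → proj₂ (push-A⁻¹-integral c l)) ⟨
        ∑ (λ l → A i l * ∑ (λ i′ → A⁻¹ l i′ * δ (σ i′) c))           ≈⟨ ∑-assoc-swap (A i) A⁻¹ (λ i′ → δ (σ i′) c) ⟨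
        ∑ (λ i′ → ∑ (λ l → A i l * A⁻¹ l i′) * δ (σ i′) c)           ≈⟨ ∑-congʳ (λ i′ → δ (σ i′) c) (A⁻¹-inverseʳ i) ⟩
        ∑ (λ i′ → δ i i′ * δ (σ i′) c)                               ≈⟨ ∑-δˡ i (λ i′ → δ (σ i′) c) ⟩
        δ (σ i) c                                                    ∎

      -- The form `φ fzero` is left out: standard vertex `fzero` is the origin, and its barycentric
      -- coordinate is 1 minus the others.
      f : AffineLatticeMap d k
      f = record { matrix = λ j l → φ (fsuc j) (fsuc l) ; translation = λ j → φ (fsuc j) fzero }

      f-vertex : ∀ i → _≋_ K (onSpace K f (v i)) (embed K (standardVertex (σ i)))
      f-vertex i j = begin
        ∑ (λ l → ι (φ (fsuc j) (fsuc l)) * ι (vertex i l)) + ι (φ (fsuc j) fzero)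
          ≈⟨ +-comm _ _ ⟩
        ι (φ (fsuc j) fzero) + ∑ (λ l → ι (φ (fsuc j) (fsuc l)) * ι (vertex i l))
          ≈⟨ +-cong (sym (trans (*-congʳ ι-1) (*-identityˡ _)))
               (sum-cong-≋ (λ l → *-comm (ι (φ (fsuc j) (fsuc l))) (ι (vertex i l)))) ⟩
        ∑ (λ l → A i l * ι (φ (fsuc j) l))
          ≈⟨ A*φ i (fsuc j) ⟩
        δ (σ i) (fsuc j)
          ≈⟨ standardVertex-δ (σ i) j ⟨
        embed K (standardVertex (σ i)) j ∎

      open VertexMap f v σ f-vertex
      open Section representative σ-representative

proposition2p24 : ∀ {c ℓ₁ ℓ₂} (K : ArchimedeanOrderedField c ℓ₁ ℓ₂) {d : ℕ} (Δ : LatticeSimplex K d) →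
    ∃[ N ] IsCodeModulus K Δ N ×
    (∀ (m : ℕ) .{{_ : NonZero m}} →
    IsCayleyOfLength K Δ m ⇔ SplitsInto m (simplexCode K Δ N))
proposition2p24 K Δ = N K Δ , N-isCodeModulus K Δ , λ
  { zero {{0≢0}} → contradiction-irr ≡.refl (ℕ.≢-nonZero⁻¹ 0 {{0≢0}})
  ; (suc k)     → mk⇔ (cayley⇒splits K Δ k) (splits⇒cayley K Δ k)
  }
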